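{- For every integer $n>16$, the generalized Petersen graph $GP(n,3)$ is not $\ell$-distance-balanced for any integer $\ell$ with $1\le \ell<{\rm diam}(GP(n,3))$. Moreover, $16$ is the smallest integer with this property; that is, the statement fails with $16$ replaced by $15$: $GP(16,3)$ is $\ell$-distance-balanced for some $1\le \ell<{\rm diam}(GP(16,3))$.
   Context: For $n\ge 3$ and $1\le k<n/2$, the generalized Petersen graph $GP(n,k)$ has vertex set $\{u_i: i\in\mathbb{Z}_n\}\cup\{v_i: i\in\mathbb{Z}_n\}$ and edge set $\{u_iu_{i+1}: i\in\mathbb{Z}_n\}\cup\{v_iv_{i+k}: i\in\mathbb{Z}_n\}\cup\{u_iv_i: i\in\mathbb{Z}_n\}$ (indices mod $n$). For a connected graph $G$ and vertices $x,y$, $d_G(x,y)$ is the shortest-path distance, ${\rm diam}(G)$ the maximum distance, and $W_{xy}=\{w\in V(G): d_G(w,x)<d_G(w,y)\}$. For an integer $1\le \ell\le {\rm diam}(G)$, $G$ is $\ell$-distance-balanced if $|W_{xy}|=|W_{yx}|$ for every pair $x,y\in V(G)$ with $d_G(x,y)=\ell$. -}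

module Defs where

open import Data.Bool using (Bool; true; false; _∧_; _∨_; if_then_else_)
open import Data.Nat using (ℕ; zero; suc; _+_; _*_; _<_; _≤_; _<ᵇ_; _≡ᵇ_; NonZero)
open import Data.Nat.DivMod using (_%_)
open import Data.Fin using (Fin; toℕ)
open import Data.Bool.ListAction using (any)
open import Data.List using (List; map; _++_; filter; length; foldr; allFin)
open import Data.Product using (_×_; _,_)
open import Data.Nat using (_⊔_)
open import Relation.Binary.PropositionalEquality using (_≡_)
open import Relation.Nullary using (¬_)
open import Relation.Nullary.Decidable using (does)
open import Data.Nat using (_<?_)

-- Vertices of GP(n,k): (false , i) is u_i and (true , i) is v_i, i ∈ ℤ_n ≅ Fin n.
Vertex : ℕ → Set
Vertex n = Bool × Fin n

vertices : (n : ℕ) → List (Vertex n)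
vertices n = map (false ,_) (allFin n) ++ map (true ,_) (allFin n)

step : (n : ℕ) → .{{NonZero n}} → ℕ → ℕ → ℕ → Bool
step n s i j = ((i + s) % n) ≡ᵇ j

adjGP : (n k : ℕ) → .{{NonZero n}} → Vertex n → Vertex n → Bool
adjGP n k (false , i) (false , j) = step n 1 (toℕ i) (toℕ j) ∨ step n 1 (toℕ j) (toℕ i)
adjGP n k (true  , i) (true  , j) = step n k (toℕ i) (toℕ j) ∨ step n k (toℕ j) (toℕ i)
adjGP n k (false , i) (true  , j) = toℕ i ≡ᵇ toℕ j
adjGP n k (true  , i) (false , j) = toℕ i ≡ᵇ toℕ j

eqV : {n : ℕ} → Vertex n → Vertex n → Bool
eqV (false , i) (false , j) = toℕ i ≡ᵇ toℕ j
eqV (true  , i) (true  , j) = toℕ i ≡ᵇ toℕ j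
eqV _ _ = false

reach : (n k : ℕ) → .{{NonZero n}} → ℕ → Vertex n → Vertex n → Bool
reach n k zero    x y = eqV x y
reach n k (suc m) x y =
  reach n k m x y ∨ any (λ z → reach n k m x z ∧ adjGP n k z y) (vertices n)

-- least m in [start, start + fuel) with reach m x y, or start + fuel if none
search : (n k : ℕ) → .{{NonZero n}} → Vertex n → Vertex n → ℕ → ℕ → ℕ
search n k x y start zero       = start
search n k x y start (suc fuel) =
  if reach n k start x y then start else search n k x y (suc start) fuel

-- Shortest-path distance d_G(x,y) in G = GP(n,k).  GP(n,k) is connected with
-- 2n vertices, so d(x,y) < 2n and the search over 0,…,2n-1 finds it exactly.
dist : (n k : ℕ) → .{{NonZero n}} → Vertex n → Vertex n → ℕ
dist n k x y = search n k x y 0 (2 * n)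

diam : (n k : ℕ) → .{{NonZero n}} → ℕ
diam n k = foldr _⊔_ 0
  (Data.List.concatMap (λ x → map (dist n k x) (vertices n)) (vertices n))
  where import Data.List

cardW : (n k : ℕ) → .{{NonZero n}} → Vertex n → Vertex n → ℕ
cardW n k x y = length (filter (λ w → dist n k w x <? dist n k w y) (vertices n))

DistBalanced : (n k : ℕ) → .{{NonZero n}} → ℕ → Set
DistBalanced n k ℓ =
  (x y : Vertex n) → dist n k x y ≡ ℓ → cardW n k x y ≡ cardW n k y x

{-# OPTIONS --safe #-}
module Submission where

-- On the line (n = ∞) the distance between u₀ and v_t, t = 3q + r, is 1 + q + r, and the
-- distances u–u and v–v are at most 2 above q + r and never below it; distances in GP(n,3) are
-- minima over the two arcs.  For x = u₀ and y = v_j the reflection exchanging u_i and v_{j−i}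
-- pairs up W_xy and W_yx: with f, h the u–u and v–v distances at offset i and g the u–v distance
-- at offset i − j, the pair indexed by i contributes [f < g] + [g < h] to |W_xy| and
-- [g < f] + [h < g] to |W_yx|.  The second is at least the first whenever h ≤ f, that is for all
-- i except ±1, ±2, and strictly larger if h ≤ g ≤ f and h < f, which happens for i = 3p about
-- halfway between 0 and j.  For ℓ ≥ 7 we take j = 3(ℓ − 3) + 2, so that g exceeds h at the four
-- exceptional i.  For ℓ ≤ 6 a fixed j works, as everything that matters happens within
-- distance 15 of 0 once n ≥ 40.  The cases n < 40, and ℓ = 5 for n = 16, are finite.

open import Defs
open import Data.Bool using (Bool; true; false; if_then_else_; not; T)
open import Data.Bool.Properties using (T-∧; T-∨; ∨-comm)
open import Data.Fin using (Fin; toℕ; fromℕ<; #_) renaming (zero to fzero; suc to fsuc)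
open import Data.Fin.Properties using (toℕ<n; toℕ-injective; toℕ-fromℕ<)
open import Data.List using (List; []; _∷_; map; _++_; foldr; filter; length; tabulate; allFin; concatMap)
open import Data.List.Membership.Propositional using (_∈_; find; lose)
open import Data.List.Membership.Propositional.Properties
  using (∈-map⁺; ∈-map⁻; ∈-++⁺ˡ; ∈-++⁺ʳ; ∈-allFin; ∈-concatMap⁺; ∈-concatMap⁻)
open import Data.List.Properties using (length-++; filter-++; map-tabulate)
open import Data.List.Relation.Unary.Any using (here; there)
open import Data.List.Relation.Unary.Any.Properties using (any⁺; any⁻)
open import Data.Nat
open import Data.Nat.DivMod
open import Data.Nat.Properties
open import Data.Nat.Tactic.RingSolver using (solve-∀)
open import Data.Product using (_×_; _,_; ∃-syntax)
open import Data.Sum using (_⊎_; inj₁; inj₂) renaming (map to ⊎-map)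
open import Function.Base using (_∘_; id)
open import Function.Bundles using (Equivalence)
open import Level using (0ℓ)
open import Relation.Binary.PropositionalEquality
open import Relation.Nullary using (¬_; Dec; yes; no; does; contradiction)
open import Relation.Nullary.Decidable using (True; toWitness; from-yes; map′; _×-dec_; _⊎-dec_; _→-dec_; ¬?)
open import Relation.Unary using (Pred; Decidable)

-- Distances on the line

-- min { |a| + |b| : a + 3b = t }
hops : ℕ → ℕ
hops 0 = 0
hops 1 = 1
hops 2 = 2
hops (suc (suc (suc t))) = suc (hops t)

-- The u-u distance on the line. From t = 3 on, a path along the inner edges costs the two spokes on
-- top of `hops`; for t = 1, 2 the outer edges alone are shorter.
outerDist : ℕ → ℕ
outerDist 0 = 0
outerDist 1 = 1
outerDist 2 = 2
outerDist (suc (suc (suc t))) = 3 + hops t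

-- The v-v distance on the line. Multiples of 3 need inner edges only; any other offset needs an
-- outer edge, hence two spokes on top of `hops`.
innerDist : ℕ → ℕ
innerDist 0 = 0
innerDist 1 = 3
innerDist 2 = 4
innerDist (suc (suc (suc t))) = suc (innerDist t)

lineDist : Bool → Bool → ℕ → ℕ
lineDist false false t = outerDist t
lineDist true  true  t = innerDist t
lineDist _     _     t = suc (hops t)

cycDist : ℕ → Bool → Bool → ℕ → ℕ
cycDist n b c k = lineDist b c k ⊓ lineDist b c (n ∸ k)

n≤2+n : ∀ n → n ≤ 2 + n
n≤2+n n = m≤n+m n 2

hops-suc : ∀ t → hops (suc t) ≤ suc (hops t)
hops-suc 0 = ≤-refl
hops-suc 1 = ≤-refl
hops-suc 2 = s≤s z≤n
hops-suc (suc (suc (suc t))) = s≤s (hops-suc t)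

hops-pred : ∀ t → hops t ≤ suc (hops (suc t))
hops-pred 0 = z≤n
hops-pred 1 = s≤s z≤n
hops-pred 2 = ≤-refl
hops-pred (suc (suc (suc t))) = s≤s (hops-pred t)

hops≤outer : ∀ t → hops t ≤ outerDist t
hops≤outer 0 = ≤-refl
hops≤outer 1 = ≤-refl
hops≤outer 2 = ≤-refl
hops≤outer (suc (suc (suc t))) = s≤s (n≤2+n _)

outer≤2+hops : ∀ t → outerDist t ≤ 2 + hops t
outer≤2+hops 0 = z≤n
outer≤2+hops 1 = s≤s z≤n
outer≤2+hops 2 = s≤s (s≤s z≤n)
outer≤2+hops (suc (suc (suc t))) = ≤-refl

hops≤inner : ∀ t → hops t ≤ innerDist t
hops≤inner 0 = ≤-refl
hops≤inner 1 = s≤s z≤n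
hops≤inner 2 = s≤s (s≤s z≤n)
hops≤inner (suc (suc (suc t))) = s≤s (hops≤inner t)

inner≤2+hops : ∀ t → innerDist t ≤ 2 + hops t
inner≤2+hops 0 = z≤n
inner≤2+hops 1 = ≤-refl
inner≤2+hops 2 = ≤-refl
inner≤2+hops (suc (suc (suc t))) = s≤s (inner≤2+hops t)

hops≤lineDist : ∀ b c t → hops t ≤ lineDist b c t
hops≤lineDist false false = hops≤outer
hops≤lineDist false true  = λ t → n≤1+n _
hops≤lineDist true  false = λ t → n≤1+n _
hops≤lineDist true  true  = hops≤inner

lineDist≤2+hops : ∀ b c t → lineDist b c t ≤ 2 + hops t
lineDist≤2+hops false false = outer≤2+hops
lineDist≤2+hops false true  = λ t → n≤1+n _
lineDist≤2+hops true  false = λ t → n≤1+n _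
lineDist≤2+hops true  true  = inner≤2+hops

hops≤id : ∀ t → hops t ≤ t
hops≤id 0 = ≤-refl
hops≤id 1 = ≤-refl
hops≤id 2 = ≤-refl
hops≤id (suc (suc (suc t))) = s≤s (≤-trans (hops≤id t) (n≤2+n t))

hops>0 : ∀ t → 1 ≤ hops (suc t)
hops>0 0 = s≤s z≤n
hops>0 1 = s≤s z≤n
hops>0 (suc (suc t)) = s≤s z≤n

-- `hops` is not monotone, but an increase of ten or more gains at least 2. This absorbs the gap
-- between `hops` and `lineDist`, so that longer windings around the cycle never help when n ≥ 10.
hops-+10 : ∀ t z → 2 + hops t ≤ hops (t + (10 + z))
hops-+10 0 z = s≤s (s≤s z≤n)
hops-+10 1 z = s≤s (s≤s (s≤s z≤n))
hops-+10 2 z = s≤s (s≤s (s≤s (s≤s z≤n)))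
hops-+10 (suc (suc (suc t))) z = s≤s (hops-+10 t z)

lineDist-+10 : ∀ b c t {s} → t + 10 ≤ s → lineDist b c t ≤ lineDist b c s
lineDist-+10 b c t {s} t+10≤s with m≤n⇒∃[o]m+o≡n t+10≤s
... | z , refl = begin
  lineDist b c t             ≤⟨ lineDist≤2+hops b c t ⟩
  2 + hops t                 ≤⟨ hops-+10 t z ⟩
  hops (t + (10 + z))        ≡⟨ cong hops (+-assoc t 10 z) ⟨
  hops (t + 10 + z)          ≤⟨ hops≤lineDist b c _ ⟩
  lineDist b c (t + 10 + z)  ∎
  where open ≤-Reasoning

lineDist-comm : ∀ b c t → lineDist b c t ≡ lineDist c b t
lineDist-comm false false t = refl
lineDist-comm false true  t = refl
lineDist-comm true  false t = refl
lineDist-comm true  true  t = refl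

outer-suc : ∀ t → outerDist (suc t) ≤ suc (outerDist t)
outer-suc 0 = ≤-refl
outer-suc 1 = ≤-refl
outer-suc 2 = ≤-refl
outer-suc (suc (suc (suc t))) = s≤s (s≤s (s≤s (hops-suc t)))

outer-pred : ∀ t → outerDist t ≤ suc (outerDist (suc t))
outer-pred 0 = z≤n
outer-pred 1 = s≤s z≤n
outer-pred 2 = s≤s (s≤s z≤n)
outer-pred (suc (suc (suc t))) = s≤s (s≤s (s≤s (hops-pred t)))

stride : Bool → ℕ
stride false = 1
stride true  = 3

-- With the next two lemmas: an edge raises the line distance by at most one, be it a rim edge away
-- from the start, a rim edge back towards it (possibly past it, hence the absolute difference) or a
-- spoke. Induction along a walk then bounds its length from below.
lineDist-forth : ∀ b c t → lineDist b c (stride c + t) ≤ suc (lineDist b c t)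
lineDist-forth false false = outer-suc
lineDist-forth true  false = s≤s ∘ hops-suc
lineDist-forth false true  = λ t → ≤-refl
lineDist-forth true  true  = λ t → ≤-refl

lineDist-back : ∀ b c t → lineDist b c ∣ t - stride c ∣ ≤ suc (lineDist b c t)
lineDist-back false false 0 = ≤-refl
lineDist-back false false (suc t) rewrite ∣-∣-identityʳ t = outer-pred t
lineDist-back true  false 0 = ≤-refl
lineDist-back true  false (suc t) rewrite ∣-∣-identityʳ t = s≤s (hops-pred t)
lineDist-back b true  0 with b
... | false = ≤-refl
... | true  = ≤-refl
lineDist-back b true  1 with b
... | false = ≤-refl
... | true  = ≤-refl
lineDist-back b true  2 with b
... | false = s≤s (s≤s z≤n)
... | true  = s≤s (s≤s (s≤s z≤n))
lineDist-back b true (suc (suc (suc t))) with b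
... | false rewrite ∣-∣-identityʳ t = s≤s (≤-trans (n≤1+n _) (n≤1+n _))
... | true  rewrite ∣-∣-identityʳ t = n≤2+n _

lineDist-spoke : ∀ b c t → lineDist b (not c) t ≤ suc (lineDist b c t)
lineDist-spoke false false t = s≤s (hops≤outer t)
lineDist-spoke false true  t = outer≤2+hops t
lineDist-spoke true  false t = inner≤2+hops t
lineDist-spoke true  true  t = s≤s (hops≤inner t)

-- The distance formula

∈-vertices : ∀ {n} (x : Vertex n) → x ∈ vertices n
∈-vertices (false , i) = ∈-++⁺ˡ (∈-map⁺ (false ,_) (∈-allFin i))
∈-vertices {n} (true  , i) = ∈-++⁺ʳ (map (false ,_) _) (∈-map⁺ (true ,_) (∈-allFin i))

eqV⇒≡ : ∀ {n} (x y : Vertex n) → T (eqV x y) → x ≡ y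
eqV⇒≡ (false , i) (false , j) e = cong (false ,_) (toℕ-injective (≡ᵇ⇒≡ _ _ e))
eqV⇒≡ (true  , i) (true  , j) e = cong (true ,_) (toℕ-injective (≡ᵇ⇒≡ _ _ e))

eqV-refl : ∀ {n} (x : Vertex n) → T (eqV x x)
eqV-refl (false , i) = ≡⇒≡ᵇ (toℕ i) (toℕ i) refl
eqV-refl (true  , i) = ≡⇒≡ᵇ (toℕ i) (toℕ i) refl

module Petersen (n : ℕ) .{{_ : NonZero n}} where

  infix 4 _≋_
  _≋_ : ℕ → ℕ → Set
  a ≋ b = a % n ≡ b % n

  ≋-+ʳ : ∀ {a b} c → a ≋ b → a + c ≋ b + c
  ≋-+ʳ {a} {b} c a≋b = begin
    (a + c) % n              ≡⟨ %-distribˡ-+ a c n ⟩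
    (a % n + c % n) % n      ≡⟨ cong (λ r → (r + c % n) % n) a≋b ⟩
    (b % n + c % n) % n      ≡⟨ %-distribˡ-+ b c n ⟨
    (b + c) % n              ∎
    where open ≡-Reasoning

  -- In place of subtraction: adding c(n - 1) completes c to the multiple cn, which vanishes mod n.
  ≋-cancelʳ : ∀ {a b} c → a + c ≋ b + c → a ≋ b
  ≋-cancelʳ {a} {b} c e = trans (sym (pad a)) (trans (≋-+ʳ (c * pred n) e) (pad b))
    where
    pad : ∀ a → a + c + c * pred n ≋ a
    pad a = begin
      (a + c + c * pred n) % n   ≡⟨ cong (_% n) (+-assoc a c _) ⟩
      (a + (c + c * pred n)) % n ≡⟨ cong (λ r → (a + r) % n) (*-suc c (pred n)) ⟨
      (a + c * suc (pred n)) % n ≡⟨ cong (λ r → (a + c * r) % n) (suc-pred n) ⟩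
      (a + c * n) % n            ≡⟨ [m+kn]%n≡m%n a c n ⟩
      a % n                      ∎
      where open ≡-Reasoning

  ≋-toℕ : ∀ {a} (i : Fin n) → a % n ≡ toℕ i → a ≋ toℕ i
  ≋-toℕ i e = trans e (sym (m<n⇒m%n≡m (toℕ<n i)))

  ≋-diff : ∀ {a i k s t} → s ≤ t → a + s ≋ k → a + t ≋ i → k + (t ∸ s) ≋ i
  ≋-diff {a} {i} {k} {s} {t} s≤t a+s≋k a+t≋i = begin
    (k + (t ∸ s)) % n       ≡⟨ ≋-+ʳ (t ∸ s) a+s≋k ⟨
    (a + s + (t ∸ s)) % n   ≡⟨ cong (_% n) (+-assoc a s _) ⟩
    (a + (s + (t ∸ s))) % n ≡⟨ cong (λ r → (a + r) % n) (m+[n∸m]≡n s≤t) ⟩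
    (a + t) % n             ≡⟨ a+t≋i ⟩
    i % n                   ∎
    where open ≡-Reasoning

  -- An offset on the line covering the cycle, unsigned and not reduced mod n; the two summands are
  -- the two directions.
  Off : ℕ → ℕ → ℕ → Set
  Off i t j = i + t ≋ j ⊎ j + t ≋ i

  -- A step in the same direction adds to the offset; a step in the opposite direction leaves the
  -- absolute difference.
  Off-turn⁺ : ∀ {i j k t s} → i + t ≋ j → Off j s k → Off i (s + t) k ⊎ Off i ∣ t - s ∣ k
  Off-turn⁺ {i} {j} {k} {t} {s} i+t≋j (inj₁ j+s≋k) = inj₁ (inj₁ (begin
    (i + (s + t)) % n ≡⟨ cong (_% n) (lemma i s t) ⟩
    (i + t + s) % n   ≡⟨ ≋-+ʳ s i+t≋j ⟩
    (j + s) % n       ≡⟨ j+s≋k ⟩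
    k % n             ∎))
    where
    open ≡-Reasoning
    lemma : ∀ i s t → i + (s + t) ≡ i + t + s
    lemma = solve-∀
  Off-turn⁺ {i} {j} {k} {t} {s} i+t≋j (inj₂ k+s≋j) with ≤-total s t
  ... | inj₁ s≤t rewrite m≤n⇒∣n-m∣≡n∸m s≤t = inj₂ (inj₁ (≋-cancelʳ s (begin
    (i + (t ∸ s) + s) % n   ≡⟨ cong (_% n) (+-assoc i (t ∸ s) s) ⟩
    (i + (t ∸ s + s)) % n   ≡⟨ cong (λ r → (i + r) % n) (m∸n+n≡m s≤t) ⟩
    (i + t) % n             ≡⟨ i+t≋j ⟩
    j % n                   ≡⟨ k+s≋j ⟨
    (k + s) % n             ∎)))
    where open ≡-Reasoning
  ... | inj₂ t≤s rewrite m≤n⇒∣m-n∣≡n∸m t≤s = inj₂ (inj₂ (≋-cancelʳ t (begin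
    (k + (s ∸ t) + t) % n   ≡⟨ cong (_% n) (+-assoc k (s ∸ t) t) ⟩
    (k + (s ∸ t + t)) % n   ≡⟨ cong (λ r → (k + r) % n) (m∸n+n≡m t≤s) ⟩
    (k + s) % n             ≡⟨ k+s≋j ⟩
    j % n                   ≡⟨ i+t≋j ⟨
    (i + t) % n             ∎)))
    where open ≡-Reasoning

  Off-turn : ∀ {i j k t s} → Off i t j → Off j s k → Off i (s + t) k ⊎ Off i ∣ t - s ∣ k
  Off-turn (inj₁ p) q = Off-turn⁺ p q
  Off-turn {i} {j} {k} {t} {s} (inj₂ j+t≋i) (inj₂ k+s≋j) = inj₁ (inj₂ (begin
    (k + (s + t)) % n ≡⟨ cong (_% n) (+-assoc k s t) ⟨
    (k + s + t) % n   ≡⟨ ≋-+ʳ t k+s≋j ⟩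
    (j + t) % n       ≡⟨ j+t≋i ⟩
    i % n             ∎))
    where open ≡-Reasoning
  Off-turn {i} {j} {k} {t} {s} (inj₂ j+t≋i) (inj₁ j+s≋k) with ≤-total s t
  ... | inj₁ s≤t rewrite m≤n⇒∣n-m∣≡n∸m s≤t = inj₂ (inj₂ (≋-diff s≤t j+s≋k j+t≋i))
  ... | inj₂ t≤s rewrite m≤n⇒∣m-n∣≡n∸m t≤s = inj₂ (inj₁ (≋-diff t≤s j+t≋i j+s≋k))

  -- A record, so that the endpoints can be inferred from the type; `adjGP` would compute away.
  record Edge (x y : Vertex n) : Set where
    constructor edge
    field adjacent : T (adjGP n 3 x y)

  infixl 5 _▸_
  data Walk (x : Vertex n) : ℕ → Vertex n → Set where
    []  : Walk x 0 x
    _▸_ : ∀ {m y z} → Walk x m y → Edge y z → Walk x (suc m) z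

  edge-sym : ∀ {x y} → Edge x y → Edge y x
  edge-sym {false , i} {false , j} (edge e) = edge (subst T (∨-comm (step n 1 (toℕ i) (toℕ j)) _) e)
  edge-sym {true  , i} {true  , j} (edge e) = edge (subst T (∨-comm (step n 3 (toℕ i) (toℕ j)) _) e)
  edge-sym {false , i} {true  , j} (edge e) = edge (≡⇒≡ᵇ (toℕ j) (toℕ i) (sym (≡ᵇ⇒≡ _ _ e)))
  edge-sym {true  , i} {false , j} (edge e) = edge (≡⇒≡ᵇ (toℕ j) (toℕ i) (sym (≡ᵇ⇒≡ _ _ e)))

  cons : ∀ {x y z m} → Edge x y → Walk y m z → Walk x (suc m) z
  cons e []      = [] ▸ e
  cons e (w ▸ f) = cons e w ▸ f

  reverse : ∀ {x y m} → Walk x m y → Walk y m x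
  reverse []      = []
  reverse (w ▸ e) = cons (edge-sym e) (reverse w)

  reach-suc : ∀ m {x y} → T (reach n 3 m x y) → T (reach n 3 (suc m) x y)
  reach-suc m r = Equivalence.from T-∨ (inj₁ r)

  reach-mono : ∀ {m m′ x y} → m ≤′ m′ → T (reach n 3 m x y) → T (reach n 3 m′ x y)
  reach-mono ≤′-refl r = r
  reach-mono {m} {suc m′} (≤′-step m≤m′) r = reach-suc m′ (reach-mono m≤m′ r)

  Walk⇒reach : ∀ {x y m} → Walk x m y → T (reach n 3 m x y)
  Walk⇒reach {x} [] = eqV-refl x
  Walk⇒reach {x} (_▸_ {y = y} w (edge e)) = Equivalence.from T-∨ (inj₂
    (any⁺ _ (lose (∈-vertices y) (Equivalence.from T-∧ (Walk⇒reach w , e)))))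

  -- The trace left on the line by a walk of length m: its endpoint lifts to some offset t whose
  -- line distance is at most m.
  Lift : ℕ → Vertex n → Vertex n → Set
  Lift m (b , i) (c , j) = ∃[ t ] (lineDist b c t ≤ m × Off (toℕ i) t (toℕ j))

  adj-cases : ∀ c {j} d {k} → T (adjGP n 3 (c , j) (d , k)) →
              (d ≡ c × Off (toℕ j) (stride c) (toℕ k)) ⊎ (d ≡ not c × j ≡ k)
  adj-cases false {j} false {k} e = inj₁ (refl , ⊎-map
    (λ f → ≋-toℕ k (≡ᵇ⇒≡ _ _ f)) (λ f → ≋-toℕ j (≡ᵇ⇒≡ _ _ f)) (Equivalence.to T-∨ e))
  adj-cases true  {j} true  {k} e = inj₁ (refl , ⊎-map
    (λ f → ≋-toℕ k (≡ᵇ⇒≡ _ _ f)) (λ f → ≋-toℕ j (≡ᵇ⇒≡ _ _ f)) (Equivalence.to T-∨ e))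
  adj-cases false true  e = inj₂ (refl , toℕ-injective (≡ᵇ⇒≡ _ _ e))
  adj-cases true  false e = inj₂ (refl , toℕ-injective (≡ᵇ⇒≡ _ _ e))

  Lift-step : ∀ {m} x y z → Lift m x y → T (adjGP n 3 y z) → Lift (suc m) x z
  Lift-step (b , i) (c , j) (d , k) (t , D≤m , o) e with adj-cases c d e
  ... | inj₂ (refl , refl) = t , ≤-trans (lineDist-spoke b c t) (s≤s D≤m) , o
  ... | inj₁ (refl , s) with Off-turn {t = t} o s
  ... | inj₁ o′ = stride c + t , ≤-trans (lineDist-forth b c t) (s≤s D≤m) , o′
  ... | inj₂ o′ = ∣ t - stride c ∣ , ≤-trans (lineDist-back b c t) (s≤s D≤m) , o′

  Lift-refl : ∀ x → Lift 0 x x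
  Lift-refl (false , i) = 0 , z≤n , inj₁ (cong (_% n) (+-identityʳ (toℕ i)))
  Lift-refl (true  , i) = 0 , z≤n , inj₁ (cong (_% n) (+-identityʳ (toℕ i)))

  reach⇒Lift : ∀ m x y → T (reach n 3 m x y) → Lift m x y
  reach⇒Lift zero x y r with eqV⇒≡ x y r
  ... | refl = Lift-refl x
  reach⇒Lift (suc m) x y r with Equivalence.to T-∨ r
  ... | inj₁ r′ with t , D≤m , o ← reach⇒Lift m x y r′ = t , m≤n⇒m≤1+n D≤m , o
  ... | inj₂ s with z , _ , e ← find (any⁻ _ (vertices n) s)
               with r′ , a ← Equivalence.to T-∧ e = Lift-step x z y (reach⇒Lift m x z r′) a

  pt : Bool → ℕ → Vertex n
  pt b t = b , t mod n

  toℕ-mod : ∀ t → toℕ (t mod n) ≡ t % n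
  toℕ-mod t = toℕ-fromℕ< (m%n<n t n)

  step-pt : ∀ t s → T (step n s (toℕ (t mod n)) (toℕ ((s + t) mod n)))
  step-pt t s = ≡⇒≡ᵇ _ _ (begin
    (toℕ (t mod n) + s) % n  ≡⟨ ≋-+ʳ s (trans (cong (_% n) (toℕ-mod t)) (m%n%n≡m%n t n)) ⟩
    (t + s) % n              ≡⟨ cong (_% n) (+-comm t s) ⟩
    (s + t) % n              ≡⟨ toℕ-mod (s + t) ⟨
    toℕ ((s + t) mod n)      ∎)
    where open ≡-Reasoning

  along : ∀ b t → Edge (pt b t) (pt b (stride b + t))
  along false t = edge (Equivalence.from T-∨ (inj₁ (step-pt t 1)))
  along true  t = edge (Equivalence.from T-∨ (inj₁ (step-pt t 3)))

  spoke : ∀ b i → Edge (b , i) (not b , i)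
  spoke false i = edge (≡⇒≡ᵇ (toℕ i) (toℕ i) refl)
  spoke true  i = edge (≡⇒≡ᵇ (toℕ i) (toℕ i) refl)

  walk-uv : ∀ s t → Walk (pt false s) (suc (hops t)) (pt true (t + s))
  walk-uv s 0 = [] ▸ spoke false _
  walk-uv s 1 = [] ▸ along false s ▸ spoke false _
  walk-uv s 2 = [] ▸ along false s ▸ along false (1 + s) ▸ spoke false _
  walk-uv s (suc (suc (suc t))) = walk-uv s t ▸ along true (t + s)

  walk-vu : ∀ s t → Walk (pt true s) (suc (hops t)) (pt false (t + s))
  walk-vu s 0 = [] ▸ spoke true _
  walk-vu s 1 = [] ▸ spoke true _ ▸ along false s
  walk-vu s 2 = [] ▸ spoke true _ ▸ along false s ▸ along false (1 + s)
  -- The walk starts on the inner rim, so its inner edges go in front, which moves the start of the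
  -- remaining walk to 3 + s.
  walk-vu s (suc (suc (suc t))) = cons (along true s)
    (subst (λ r → Walk (pt true (3 + s)) (suc (hops t)) (pt false r)) (lemma t s) (walk-vu (3 + s) t))
    where
    lemma : ∀ t s → t + (3 + s) ≡ 3 + t + s
    lemma = solve-∀

  walk-uu : ∀ s t → Walk (pt false s) (outerDist t) (pt false (t + s))
  walk-uu s 0 = []
  walk-uu s 1 = [] ▸ along false s
  walk-uu s 2 = [] ▸ along false s ▸ along false (1 + s)
  walk-uu s (suc (suc (suc t))) = walk-uv s t ▸ along true (t + s) ▸ spoke true _

  walk-vv : ∀ s t → Walk (pt true s) (innerDist t) (pt true (t + s))
  walk-vv s 0 = []
  walk-vv s 1 = [] ▸ spoke true _ ▸ along false s ▸ spoke false _
  walk-vv s 2 = [] ▸ spoke true _ ▸ along false s ▸ along false (1 + s) ▸ spoke false _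
  walk-vv s (suc (suc (suc t))) = walk-vv s t ▸ along true (t + s)

  walk : ∀ b c s t → Walk (pt b s) (lineDist b c t) (pt c (t + s))
  walk false false = walk-uu
  walk false true  = walk-uv
  walk true  false = walk-vu
  walk true  true  = walk-vv

  pt-toℕ : ∀ b {a} (i : Fin n) → a ≋ toℕ i → pt b a ≡ (b , i)
  pt-toℕ b {a} i a≋i = cong (b ,_) (toℕ-injective (begin
    toℕ (a mod n) ≡⟨ toℕ-mod a ⟩
    a % n         ≡⟨ a≋i ⟩
    toℕ i % n     ≡⟨ m<n⇒m%n≡m (toℕ<n i) ⟩
    toℕ i         ∎))
    where open ≡-Reasoning

  Off⇒Walk : ∀ b c {i j} t → Off (toℕ i) t (toℕ j) → Walk (b , i) (lineDist b c t) (c , j)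
  Off⇒Walk b c {i} {j} t (inj₁ o) = subst₂ (λ x y → Walk x (lineDist b c t) y)
    (pt-toℕ b i refl)
    (pt-toℕ c j (trans (cong (_% n) (+-comm t (toℕ i))) o))
    (walk b c (toℕ i) t)
  Off⇒Walk b c {i} {j} t (inj₂ o) = subst (λ m → Walk (b , i) m (c , j)) (lineDist-comm c b t)
    (reverse (Off⇒Walk c b t (inj₁ o)))

  off-direct : ∀ i j → Off i ∣ i - j ∣ j
  off-direct i j with ≤-total i j
  ... | inj₁ i≤j rewrite m≤n⇒∣m-n∣≡n∸m i≤j = inj₁ (cong (_% n) (m+[n∸m]≡n i≤j))
  ... | inj₂ j≤i rewrite m≤n⇒∣n-m∣≡n∸m j≤i = inj₂ (cong (_% n) (m+[n∸m]≡n j≤i))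

  wrap-≋ : ∀ {i j} → i ≤ j → j ∸ i ≤ n → j + (n ∸ (j ∸ i)) ≋ i
  wrap-≋ {i} {j} i≤j j∸i≤n = begin
    (j + (n ∸ (j ∸ i))) % n             ≡⟨ cong (λ r → (r + (n ∸ (j ∸ i))) % n) (m+[n∸m]≡n i≤j) ⟨
    (i + (j ∸ i) + (n ∸ (j ∸ i))) % n   ≡⟨ cong (_% n) (+-assoc i (j ∸ i) _) ⟩
    (i + (j ∸ i + (n ∸ (j ∸ i)))) % n   ≡⟨ cong (λ r → (i + r) % n) (m+[n∸m]≡n j∸i≤n) ⟩
    (i + n) % n                         ≡⟨ [m+n]%n≡m%n i n ⟩
    i % n                               ∎
    where open ≡-Reasoning

  off-wrap : ∀ {i j} → i < n → j < n → Off i (n ∸ ∣ i - j ∣) j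
  off-wrap {i} {j} i<n j<n with ≤-total i j
  ... | inj₁ i≤j rewrite m≤n⇒∣m-n∣≡n∸m i≤j = inj₂ (wrap-≋ i≤j (≤-trans (m∸n≤m j i) (<⇒≤ j<n)))
  ... | inj₂ j≤i rewrite m≤n⇒∣n-m∣≡n∸m j≤i = inj₁ (wrap-≋ j≤i (≤-trans (m∸n≤m i j) (<⇒≤ i<n)))

  cycWalk : ∀ b c i j → Walk (b , i) (cycDist n b c ∣ toℕ i - toℕ j ∣) (c , j)
  cycWalk b c i j with ⊓-sel (lineDist b c ∣ toℕ i - toℕ j ∣) (lineDist b c (n ∸ ∣ toℕ i - toℕ j ∣))
  ... | inj₁ e rewrite e = Off⇒Walk b c _ (off-direct (toℕ i) (toℕ j))
  ... | inj₂ e rewrite e = Off⇒Walk b c _ (off-wrap (toℕ<n i) (toℕ<n j))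

  lineDist-+* : 10 ≤ n → ∀ b c t q → lineDist b c t ≤ lineDist b c (t + q * n)
  lineDist-+* 10≤n b c t zero rewrite +-identityʳ t = ≤-refl
  lineDist-+* 10≤n b c t (suc q) = lineDist-+10 b c t (+-monoʳ-≤ t (≤-trans 10≤n (m≤m+n n (q * n))))

  -- Write i + t = j + qn. If i ≤ j, then t is j - i plus q full turns; if j ≤ i, then t is n - (i -
  -- j) plus q - 1 full turns. Full turns do not shorten the distance.
  cycDist-≤⁺ : 10 ≤ n → ∀ b c {i j} t → i < n → j < n → i + t ≋ j → cycDist n b c ∣ i - j ∣ ≤ lineDist b c t
  cycDist-≤⁺ 10≤n b c {i} {j} t i<n j<n o = go (≤-total i j)
    where
    q = (i + t) / n
    i+t≡ : i + t ≡ j + q * n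
    i+t≡ = trans (m≡m%n+[m/n]*n (i + t) n) (cong (_+ q * n) (trans o (m<n⇒m%n≡m j<n)))
    go : i ≤ j ⊎ j ≤ i → cycDist n b c ∣ i - j ∣ ≤ lineDist b c t
    go (inj₁ i≤j) rewrite m≤n⇒∣m-n∣≡n∸m i≤j =
      ≤-trans (m⊓n≤m _ _) (≤-trans (lineDist-+* 10≤n b c (j ∸ i) q) (≤-reflexive (cong (lineDist b c) (sym t≡))))
      where
      t≡ : t ≡ j ∸ i + q * n
      t≡ = +-cancelˡ-≡ i t _ (begin
        i + t                 ≡⟨ i+t≡ ⟩
        j + q * n             ≡⟨ cong (_+ q * n) (m+[n∸m]≡n i≤j) ⟨
        i + (j ∸ i) + q * n   ≡⟨ +-assoc i (j ∸ i) _ ⟩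
        i + (j ∸ i + q * n)   ∎)
        where open ≡-Reasoning
    go (inj₂ j≤i) rewrite m≤n⇒∣n-m∣≡n∸m j≤i = go′ q k+t≡
      where
      k = i ∸ j
      k≤n : k ≤ n
      k≤n = ≤-trans (m∸n≤m i j) (<⇒≤ i<n)
      k+t≡ : k + t ≡ q * n
      k+t≡ = +-cancelˡ-≡ j _ _ (begin
        j + (k + t)   ≡⟨ +-assoc j k t ⟨
        j + k + t     ≡⟨ cong (_+ t) (m+[n∸m]≡n j≤i) ⟩
        i + t         ≡⟨ i+t≡ ⟩
        j + q * n     ∎)
        where open ≡-Reasoning
      go′ : ∀ q → k + t ≡ q * n → lineDist b c k ⊓ lineDist b c (n ∸ k) ≤ lineDist b c t
      -- No full turn is left to split off: q = 0 forces i = j and t = 0.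
      go′ zero e rewrite m+n≡0⇒m≡0 k e | m+n≡0⇒n≡0 k e = m⊓n≤m _ _
      go′ (suc q) e = ≤-trans (m⊓n≤n _ _)
        (≤-trans (lineDist-+* 10≤n b c (n ∸ k) q) (≤-reflexive (cong (lineDist b c) (sym t≡))))
        where
        t≡ : t ≡ n ∸ k + q * n
        t≡ = +-cancelˡ-≡ k t _ (begin
          k + t                 ≡⟨ e ⟩
          n + q * n             ≡⟨ cong (_+ q * n) (m+[n∸m]≡n k≤n) ⟨
          k + (n ∸ k) + q * n   ≡⟨ +-assoc k (n ∸ k) _ ⟩
          k + (n ∸ k + q * n)   ∎)
          where open ≡-Reasoning

  cycDist-≤ : 10 ≤ n → ∀ b c {i j} t → i < n → j < n → Off i t j → cycDist n b c ∣ i - j ∣ ≤ lineDist b c t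
  cycDist-≤ 10≤n b c t i<n j<n (inj₁ o) = cycDist-≤⁺ 10≤n b c t i<n j<n o
  cycDist-≤ 10≤n b c {i} {j} t i<n j<n (inj₂ o) rewrite ∣-∣-comm i j = cycDist-≤⁺ 10≤n b c t j<n i<n o

  -- The two hypotheses say that `reach` holds at m exactly when D ≤ m, so the search fails below D
  -- and stops at D. If the fuel runs out, the default `start` is D itself.
  search-least : ∀ x y fuel start {D} → (∀ m → D ≤ m → T (reach n 3 m x y)) →
                 (∀ m → T (reach n 3 m x y) → D ≤ m) →
                 start ≤ D → D ≤ start + fuel → search n 3 x y start fuel ≡ D
  search-least x y zero start up low s≤D D≤s = ≤-antisym s≤D (subst (_ ≤_) (+-identityʳ start) D≤s)
  search-least x y (suc fuel) start {D} up low s≤D D≤s with reach n 3 start x y in eq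
  ... | true = ≤-antisym s≤D (low start (subst T (sym eq) _))
  ... | false = search-least x y fuel (suc start) up low (≤∧≢⇒< s≤D s≢D) (subst (D ≤_) (+-suc start fuel) D≤s)
    where
    s≢D : start ≢ D
    s≢D refl = subst T eq (up start ≤-refl)

  -- Explicit walks along either arc give the upper bound; lifting an arbitrary walk to the line
  -- gives the lower one.
  dist≡ : 10 ≤ n → ∀ b c i j → dist n 3 (b , i) (c , j) ≡ cycDist n b c ∣ toℕ i - toℕ j ∣
  dist≡ 10≤n b c i j = search-least (b , i) (c , j) (2 * n) 0 up low z≤n bound
    where
    k = ∣ toℕ i - toℕ j ∣
    up : ∀ m → cycDist n b c k ≤ m → T (reach n 3 m (b , i) (c , j))
    up m D≤m = reach-mono (≤⇒≤′ D≤m) (Walk⇒reach (cycWalk b c i j))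
    low : ∀ m → T (reach n 3 m (b , i) (c , j)) → cycDist n b c k ≤ m
    low m r with t , D≤m , o ← reach⇒Lift m _ _ r =
      ≤-trans (cycDist-≤ 10≤n b c t (toℕ<n i) (toℕ<n j) o) D≤m
    bound : cycDist n b c k ≤ 2 * n
    bound = begin
      cycDist n b c k  ≤⟨ m⊓n≤m _ _ ⟩
      lineDist b c k   ≤⟨ lineDist≤2+hops b c k ⟩
      2 + hops k       ≤⟨ s≤s (s≤s (hops≤id k)) ⟩
      2 + k            ≤⟨ +-mono-≤ (≤-trans (s≤s (s≤s z≤n)) 10≤n)
                           (≤-trans (∣m-n∣≤m⊔n (toℕ i) (toℕ j)) (⊔-lub (<⇒≤ (toℕ<n i)) (<⇒≤ (toℕ<n j)))) ⟩
      n + n            ≡⟨ cong (n +_) (+-identityʳ n) ⟨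
      2 * n            ∎
      where open ≤-Reasoning

-- Sums and the two cardinalities

Σ< : ℕ → (ℕ → ℕ) → ℕ
Σ< zero    f = 0
Σ< (suc n) f = f 0 + Σ< n (f ∘ suc)

Σ<-cong : ∀ n {f g : ℕ → ℕ} → (∀ i → i < n → f i ≡ g i) → Σ< n f ≡ Σ< n g
Σ<-cong zero    f≡g = refl
Σ<-cong (suc n) f≡g = cong₂ _+_ (f≡g 0 z<s) (Σ<-cong n (λ i i<n → f≡g (suc i) (s<s i<n)))

Σ<-mono : ∀ n {f g : ℕ → ℕ} → (∀ i → i < n → f i ≤ g i) → Σ< n f ≤ Σ< n g
Σ<-mono zero    f≤g = z≤n
Σ<-mono (suc n) f≤g = +-mono-≤ (f≤g 0 z<s) (Σ<-mono n (λ i i<n → f≤g (suc i) (s<s i<n)))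

Σ<-mono-< : ∀ n {f g : ℕ → ℕ} → (∀ i → i < n → f i ≤ g i) → ∀ {p} → p < n → f p < g p → Σ< n f < Σ< n g
Σ<-mono-< (suc n) f≤g {zero}  p<n fp<gp =
  +-mono-<-≤ fp<gp (Σ<-mono n (λ i i<n → f≤g (suc i) (s<s i<n)))
Σ<-mono-< (suc n) f≤g {suc p} p<n fp<gp =
  +-mono-≤-< (f≤g 0 z<s) (Σ<-mono-< n (λ i i<n → f≤g (suc i) (s<s i<n)) (s<s⁻¹ p<n) fp<gp)

Σ<-split : ∀ m n f → Σ< (m + n) f ≡ Σ< m f + Σ< n (f ∘ (m +_))
Σ<-split zero    n f = refl
Σ<-split (suc m) n f = trans (cong (f 0 +_) (Σ<-split m n (f ∘ suc))) (sym (+-assoc (f 0) _ _))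

Σ<-last : ∀ n f → Σ< (suc n) f ≡ f n + Σ< n f
Σ<-last zero    f = refl
Σ<-last (suc n) f = trans (cong (f 0 +_) (Σ<-last n (f ∘ suc))) (swap-head (f 0) (f (suc n)) _)
  where
  swap-head : ∀ a b c → a + (b + c) ≡ b + (a + c)
  swap-head = solve-∀

Σ<-reverse : ∀ n f → Σ< n f ≡ Σ< n (λ i → f (n ∸ suc i))
Σ<-reverse zero    f = refl
Σ<-reverse (suc n) f = trans (Σ<-last n f) (cong (f n +_) (Σ<-reverse n f))

Σ<-+ : ∀ n f g → Σ< n f + Σ< n g ≡ Σ< n (λ i → f i + g i)
Σ<-+ zero    f g = refl
Σ<-+ (suc n) f g = trans (shuffle (f 0) (Σ< n (f ∘ suc)) (g 0) _)
                         (cong (f 0 + g 0 +_) (Σ<-+ n (f ∘ suc) (g ∘ suc)))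
  where
  shuffle : ∀ a b c d → (a + b) + (c + d) ≡ (a + c) + (b + d)
  shuffle = solve-∀

∣+ˡ-∣ : ∀ j s → ∣ j + s - j ∣ ≡ s
∣+ˡ-∣ j s = trans (∣-∣-comm (j + s) j) (∣m-m+n∣≡n j s)

-- Reindexing by the reflection i ↦ j - i mod n. On 0, ..., j it exchanges i and |i - j|; beyond j
-- it is i ↦ n + j - i, which also replaces both by their complements to n, and there the symmetry
-- of `P` is used.
Σ<-reflect : ∀ {n j} (P : ℕ → ℕ → ℕ) → j < n →
             (∀ {k l} → k ≤ n → l ≤ n → P (n ∸ k) (n ∸ l) ≡ P k l) →
             Σ< n (λ i → P i ∣ i - j ∣) ≡ Σ< n (λ i → P ∣ i - j ∣ i)
Σ<-reflect {n} {j} P j<n P-sym with m≤n⇒∃[o]m+o≡n j<n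
... | r , refl = begin
  Σ< (suc j + r) (λ i → P i ∣ i - j ∣)
    ≡⟨ Σ<-split (suc j) r F ⟩
  Σ< (suc j) (λ i → P i ∣ i - j ∣) + Σ< r (λ i → P (suc j + i) ∣ suc j + i - j ∣)
    ≡⟨ cong₂ _+_ (trans (Σ<-reverse (suc j) F) (Σ<-cong (suc j) low))
                 (trans (Σ<-reverse r (F ∘ (suc j +_))) (Σ<-cong r high)) ⟩
  Σ< (suc j) (λ i → P ∣ i - j ∣ i) + Σ< r (λ i → P ∣ suc j + i - j ∣ (suc j + i))
    ≡⟨ Σ<-split (suc j) r G ⟨
  Σ< (suc j + r) (λ i → P ∣ i - j ∣ i) ∎
  where
  open ≡-Reasoning
  F G : ℕ → ℕ
  F i = P i ∣ i - j ∣
  G i = P ∣ i - j ∣ i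
  ∣+suc-∣ : ∀ s → ∣ suc j + s - j ∣ ≡ suc s
  ∣+suc-∣ s = trans (cong (λ a → ∣ a - j ∣) (sym (+-suc j s))) (∣+ˡ-∣ j (suc s))
  low : ∀ i → i < suc j → P (j ∸ i) ∣ j ∸ i - j ∣ ≡ P ∣ i - j ∣ i
  low i i<1+j = cong₂ P (sym (m≤n⇒∣m-n∣≡n∸m i≤j))
    (trans (m≤n⇒∣m-n∣≡n∸m (m∸n≤m j i)) (m∸[m∸n]≡n i≤j))
    where i≤j = s≤s⁻¹ i<1+j
  high : ∀ i → i < r → P (suc j + (r ∸ suc i)) ∣ suc j + (r ∸ suc i) - j ∣ ≡ P ∣ suc j + i - j ∣ (suc j + i)
  high i i<r with m≤n⇒∃[o]m+o≡n i<r
  ... | s , refl rewrite m+n∸m≡n i s | ∣+suc-∣ s | ∣+suc-∣ i = begin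
    P (suc j + s) (suc s)                     ≡⟨ cong₂ P k≡ l≡ ⟩
    P (n ∸ suc i) (n ∸ (suc j + i))           ≡⟨ P-sym k≤n l≤n ⟩
    P (suc i) (suc j + i)                     ∎
    where
    n≡ : ∀ j i s → suc j + (suc i + s) ≡ suc i + (suc j + s)
    n≡ = solve-∀
    n≡′ : ∀ j i s → suc j + (suc i + s) ≡ suc j + i + suc s
    n≡′ = solve-∀
    k≤n : suc i ≤ n
    k≤n = subst (suc i ≤_) (sym (n≡ j i s)) (m≤m+n (suc i) _)
    l≤n : suc j + i ≤ n
    l≤n = subst (suc j + i ≤_) (sym (n≡′ j i s)) (m≤m+n (suc j + i) _)
    k≡ : suc j + s ≡ n ∸ suc i
    k≡ = sym (trans (cong (_∸ suc i) (n≡ j i s)) (m+n∸m≡n (suc i) _))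
    l≡ : suc s ≡ n ∸ (suc j + i)
    l≡ = sym (trans (cong (_∸ (suc j + i)) (n≡′ j i s)) (m+n∸m≡n (suc j + i) _))

ind : ℕ → ℕ → ℕ
ind a b = if a <ᵇ b then 1 else 0

ind≤1 : ∀ a b → ind a b ≤ 1
ind≤1 a b with a <ᵇ b
... | true  = ≤-refl
... | false = z≤n

ind-< : ∀ {a b} → a < b → ind a b ≡ 1
ind-< {a} {b} a<b with a <ᵇ b | <⇒<ᵇ a<b
... | true | _ = refl

ind-≥ : ∀ {a b} → b ≤ a → ind a b ≡ 0
ind-≥ {a} {b} b≤a with a <ᵇ b in eq
... | true  = contradiction (<ᵇ⇒< a b (subst T (sym eq) _)) (≤⇒≯ b≤a)
... | false = refl

ind-mono : ∀ {a a′ b b′} → a′ ≤ a → b ≤ b′ → ind a b ≤ ind a′ b′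
ind-mono {a} {a′} {b} {b′} a′≤a b≤b′ with a <? b
... | yes a<b = ≤-trans (ind≤1 a b) (≤-reflexive (sym (ind-< (≤-<-trans a′≤a (<-≤-trans a<b b≤b′)))))
... | no  a≮b rewrite ind-≥ (≮⇒≥ a≮b) = z≤n

length-filter-tabulate : ∀ n {A : Set} {P : Pred A 0ℓ} (P? : Decidable P) (g : Fin n → A) (f : ℕ → ℕ) →
  (∀ i → (if does (P? (g i)) then 1 else 0) ≡ f (toℕ i)) → length (filter P? (tabulate g)) ≡ Σ< n f
length-filter-tabulate zero    P? g f e = refl
length-filter-tabulate (suc n) P? g f e with does (P? (g fzero)) | e fzero
... | true  | f0 = cong₂ _+_ f0 (length-filter-tabulate n P? (g ∘ fsuc) (f ∘ suc) (e ∘ fsuc))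
... | false | f0 = cong₂ _+_ f0 (length-filter-tabulate n P? (g ∘ fsuc) (f ∘ suc) (e ∘ fsuc))

closer : ℕ → Bool → Bool → ℕ → Bool → ℕ → ℕ
closer n a b i c j = Σ< n (λ l → ind (cycDist n a b ∣ l - i ∣) (cycDist n a c ∣ l - j ∣))

module _ (n : ℕ) .{{_ : NonZero n}} (10≤n : 10 ≤ n) where
  open Petersen n using (dist≡)

  cardW≡ : ∀ b i c j → cardW n 3 (b , i) (c , j) ≡
           closer n false b (toℕ i) c (toℕ j) + closer n true b (toℕ i) c (toℕ j)
  cardW≡ b i c j = begin
    length (filter P? (map (false ,_) (allFin n) ++ map (true ,_) (allFin n)))
      ≡⟨ cong length (filter-++ P? (map (false ,_) (allFin n)) _) ⟩
    length (filter P? (map (false ,_) (allFin n)) ++ filter P? (map (true ,_) (allFin n)))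
      ≡⟨ length-++ (filter P? (map (false ,_) (allFin n))) ⟩
    length (filter P? (map (false ,_) (allFin n))) + length (filter P? (map (true ,_) (allFin n)))
      ≡⟨ cong₂ _+_ (half false) (half true) ⟩
    closer n false b (toℕ i) c (toℕ j) + closer n true b (toℕ i) c (toℕ j) ∎
    where
    open ≡-Reasoning
    P? = λ w → dist n 3 w (b , i) <? dist n 3 w (c , j)
    half : ∀ a → length (filter P? (map (a ,_) (allFin n))) ≡ closer n a b (toℕ i) c (toℕ j)
    half a = trans (cong (length ∘ filter P?) (map-tabulate id (a ,_)))
      (length-filter-tabulate n P? (a ,_) _
        (λ l → cong₂ ind (dist≡ 10≤n a b l i) (dist≡ 10≤n a c l j)))

-- Distances and the diameter

<foldr-⊔⇒∃ : ∀ {m} xs → m < foldr _⊔_ 0 xs → ∃[ x ] (x ∈ xs × m < x)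
<foldr-⊔⇒∃ (x ∷ xs) m<max with ⊔-sel x (foldr _⊔_ 0 xs)
... | inj₁ e = x , here refl , subst (_ <_) e m<max
... | inj₂ e with y , y∈xs , m<y ← <foldr-⊔⇒∃ xs (subst (_ <_) e m<max) = y , there y∈xs , m<y

∈⇒≤foldr-⊔ : ∀ {x xs} → x ∈ xs → x ≤ foldr _⊔_ 0 xs
∈⇒≤foldr-⊔ (here refl)      = m≤m⊔n _ _
∈⇒≤foldr-⊔ (there {y} x∈xs) = ≤-trans (∈⇒≤foldr-⊔ x∈xs) (m≤n⊔m y _)

<diam⇒∃ : ∀ n .{{_ : NonZero n}} {ℓ} → ℓ < diam n 3 → ∃[ x ] ∃[ y ] ℓ < dist n 3 x y
<diam⇒∃ n ℓ<diam with d , d∈ , ℓ<d ← <foldr-⊔⇒∃ (concatMap (λ x → map (dist n 3 x) (vertices n)) (vertices n)) ℓ<diam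
                  with x , _ , d∈x ← find (∈-concatMap⁻ (λ x → map (dist n 3 x) (vertices n)) {vertices n} d∈)
                  with y , _ , refl ← ∈-map⁻ (dist n 3 x) d∈x = x , y , ℓ<d

dist≤diam : ∀ n .{{_ : NonZero n}} x y → dist n 3 x y ≤ diam n 3
dist≤diam n x y = ∈⇒≤foldr-⊔ (∈-concatMap⁺ (λ x → map (dist n 3 x) (vertices n))
  (lose (∈-vertices x) (∈-map⁺ (dist n 3 x) (∈-vertices y))))

-- The reflection pairing for x = u₀ and y = v_j

nearU nearV : ℕ → ℕ → ℕ → ℕ
nearU f g h = ind f g + ind g h
nearV f g h = ind g f + ind h g

-- If h ≤ f, then [f < g] ≤ [h < g] and [g < h] ≤ [g < f]. If h < g, then [g < h] = 0 while [h < g]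
-- = 1.
nearU≤nearV : ∀ {f h} g → h ≤ f ⊎ h < g → nearU f g h ≤ nearV f g h
nearU≤nearV {f} {h} g (inj₁ h≤f) = ≤-trans
  (+-mono-≤ (ind-mono {b = g} h≤f ≤-refl) (ind-mono {a = g} ≤-refl h≤f))
  (≤-reflexive (+-comm (ind h g) (ind g f)))
nearU≤nearV {f} {h} g (inj₂ h<g) rewrite ind-≥ (<⇒≤ h<g) | ind-< h<g =
  subst (_≤ ind g f + 1) (sym (+-identityʳ _)) (≤-trans (ind≤1 f g) (m≤n+m 1 _))

-- Both indicators on the left vanish, and h < f makes one of h ≤ g, g ≤ f strict.
nearU<nearV : ∀ {f g h} → h < f → h ≤ g → g ≤ f → nearU f g h < nearV f g h
nearU<nearV {f} {g} {h} h<f h≤g g≤f rewrite ind-≥ g≤f | ind-≥ h≤g with h <? g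
... | yes h<g rewrite ind-< h<g = m≤n+m 1 _
... | no  h≮g rewrite ind-< (≤-<-trans (≮⇒≥ h≮g) h<f) = s≤s z≤n

-- The contribution of the pair u_i, v_{j-i}: the first is at offsets i and |i - j| from u₀ and v_j,
-- the second at the same offsets exchanged.
reflected : ℕ → (ℕ → ℕ → ℕ → ℕ) → ℕ → ℕ → ℕ
reflected n near j i = near (cycDist n false false i) (cycDist n false true ∣ i - j ∣) (cycDist n true true i)

cycDist-∸ : ∀ {n} b c {k} → k ≤ n → cycDist n b c (n ∸ k) ≡ cycDist n b c k
cycDist-∸ {n} b c {k} k≤n rewrite m∸[m∸n]≡n k≤n = ⊓-comm (lineDist b c (n ∸ k)) (lineDist b c k)

countU≡ : ∀ {n j} → j < n →
  closer n false false 0 true j + closer n true false 0 true j ≡ Σ< n (reflected n nearU j)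
countU≡ {n} {j} j<n = trans (cong₂ _+_
    (Σ<-cong n (λ l _ → cong (λ k → ind (cycDist n false false k) (cycDist n false true ∣ l - j ∣)) (∣-∣-identityʳ l)))
    (trans (Σ<-cong n (λ l _ → cong (λ k → ind (cycDist n false true k) (cycDist n true true ∣ l - j ∣)) (∣-∣-identityʳ l)))
      -- Only the inner rim is reindexed; on the outer rim the index is already the offset from u₀.
      (Σ<-reflect (λ k l → ind (cycDist n false true k) (cycDist n true true l)) j<n
        (λ k≤n l≤n → cong₂ ind (cycDist-∸ false true k≤n) (cycDist-∸ true true l≤n)))))
  (Σ<-+ n _ _)

countV≡ : ∀ {n j} → j < n →
  closer n false true j false 0 + closer n true true j false 0 ≡ Σ< n (reflected n nearV j)
countV≡ {n} {j} j<n = trans (cong₂ _+_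
    (Σ<-cong n (λ l _ → cong (λ k → ind (cycDist n false true ∣ l - j ∣) (cycDist n false false k)) (∣-∣-identityʳ l)))
    (trans (Σ<-cong n (λ l _ → cong (λ k → ind (cycDist n true true ∣ l - j ∣) (cycDist n false true k)) (∣-∣-identityʳ l)))
      (sym (Σ<-reflect (λ k l → ind (cycDist n true true k) (cycDist n false true l)) j<n
        (λ k≤n l≤n → cong₂ ind (cycDist-∸ true true k≤n) (cycDist-∸ false true l≤n))))))
  (Σ<-+ n _ _)

-- A record rather than a pair, so that with-abstraction does not normalise the sums.
record Unbalanced (n ℓ j : ℕ) : Set where
  constructor _,_
  field
    distance : cycDist n false true j ≡ ℓ
    differ   : Σ< n (reflected n nearU j) ≢ Σ< n (reflected n nearV j)

Unbalanced⇒¬DistBalanced : ∀ {n} .{{_ : NonZero n}} {ℓ j} → 10 ≤ n → j < n → Unbalanced n ℓ j → ¬ DistBalanced n 3 ℓ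
Unbalanced⇒¬DistBalanced {n} {ℓ} {j} 10≤n j<n (dj≡ℓ , U≢V) bal = U≢V (begin
  Σ< n (reflected n nearU j)
    ≡⟨ countU≡ j<n ⟨
  closer n false false 0 true j + closer n true false 0 true j
    ≡⟨ cong₂ (λ a b → closer n false false a true b + closer n true false a true b) o≡0 v≡j ⟨
  _ ≡⟨ cardW≡ n 10≤n false o true v ⟨
  cardW n 3 (false , o) (true , v)
    ≡⟨ bal (false , o) (true , v) d≡ℓ ⟩
  cardW n 3 (true , v) (false , o)
    ≡⟨ cardW≡ n 10≤n true v false o ⟩
  _ ≡⟨ cong₂ (λ a b → closer n false true b false a + closer n true true b false a) o≡0 v≡j ⟩
  closer n false true j false 0 + closer n true true j false 0
    ≡⟨ countV≡ j<n ⟩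
  Σ< n (reflected n nearV j) ∎)
  where
  open ≡-Reasoning
  0<n = ≤-trans (s≤s z≤n) 10≤n
  o = fromℕ< 0<n
  v = fromℕ< j<n
  o≡0 : toℕ o ≡ 0
  o≡0 = toℕ-fromℕ< 0<n
  v≡j : toℕ v ≡ j
  v≡j = toℕ-fromℕ< j<n
  d≡ℓ : dist n 3 (false , o) (true , v) ≡ ℓ
  d≡ℓ = trans (Petersen.dist≡ n 10≤n false true o v)
    (trans (cong₂ (λ a b → cycDist n false true ∣ a - b ∣) o≡0 v≡j) dj≡ℓ)

-- At a fixed offset every distance exceeds the u-v distance by at most one. So a pair of any kind
-- at distance greater than ℓ yields an offset whose u-v distance is at least ℓ.
<diam⇒≤cycDist : ∀ {n} .{{_ : NonZero n}} {ℓ} → 10 ≤ n → ℓ < diam n 3 → ∃[ k ] (k < n × ℓ ≤ cycDist n false true k)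
<diam⇒≤cycDist {n} {ℓ} 10≤n ℓ<diam with (b , i) , (c , j) , ℓ<d ← <diam⇒∃ n ℓ<diam =
  k , ≤-<-trans (∣m-n∣≤m⊔n (toℕ i) (toℕ j)) (⊔-pres-<m (toℕ<n i) (toℕ<n j)) ,
  s≤s⁻¹ (≤-trans (subst (ℓ <_) (Petersen.dist≡ n 10≤n b c i j) ℓ<d)
                 (⊓-mono-≤ (lineDist≤2+hops b c k) (lineDist≤2+hops b c (n ∸ k))))
  where k = ∣ toℕ i - toℕ j ∣

-- Finite cases

Unbalanced? : ∀ n ℓ j → Dec (Unbalanced n ℓ j)
Unbalanced? n ℓ j = map′ (λ (d , U≢V) → d , U≢V) (λ (d , U≢V) → d , U≢V) ((_ ≟ ℓ) ×-dec ¬? (_ ≟ _))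

-- By evaluation for n = 17, ..., 39. The range ℓ < 12 covers every u-v distance for these n, by
-- `cycDist-<40`; the middle alternative disposes of those ℓ that are too large for the given n.
unbalanced-table : ∀ {z} → z < 23 → ∀ {ℓ} → ℓ < 12 → ℓ ≡ 0 ⊎
  (∀ {k} → k < 17 + z → cycDist (17 + z) false true k < ℓ) ⊎ ∃[ j ] (j < 17 + z × Unbalanced (17 + z) ℓ j)
unbalanced-table = from-yes (allUpTo? (λ z → allUpTo? (λ ℓ → (ℓ ≟ 0) ⊎-dec
  (allUpTo? (λ k → cycDist (17 + z) false true k <? ℓ) (17 + z) ⊎-dec anyUpTo? (Unbalanced? (17 + z) ℓ) (17 + z))) 12) 23)

cycDist-<40 : ∀ {z} → z < 23 → ∀ {k} → k < 17 + z → cycDist (17 + z) false true k < 12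
cycDist-<40 = from-yes (allUpTo? (λ z → allUpTo? (λ k → cycDist (17 + z) false true k <? 12) (17 + z)) 23)

balanced-16 : ∀ b c {i} → i < 16 → ∀ {j} → j < 16 → cycDist 16 b c ∣ i - j ∣ ≡ 5 →
  closer 16 false b i c j + closer 16 true b i c j ≡ closer 16 false c j b i + closer 16 true c j b i
balanced-16 b c = go b c
  where
  go? : ∀ b c → Dec (∀ {i} → i < 16 → ∀ {j} → j < 16 → cycDist 16 b c ∣ i - j ∣ ≡ 5 →
    closer 16 false b i c j + closer 16 true b i c j ≡ closer 16 false c j b i + closer 16 true c j b i)
  go? b c = allUpTo? (λ i → allUpTo? (λ j → (_ ≟ 5) →-dec (_ ≟ _)) 16) 16
  go : ∀ b c {i} → i < 16 → ∀ {j} → j < 16 → cycDist 16 b c ∣ i - j ∣ ≡ 5 →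
    closer 16 false b i c j + closer 16 true b i c j ≡ closer 16 false c j b i + closer 16 true c j b i
  -- The rims are split first because the decision procedure evaluates only for concrete b and c.
  go false false = from-yes (go? false false)
  go false true  = from-yes (go? false true)
  go true  false = from-yes (go? true false)
  go true  true  = from-yes (go? true true)

-- From offset 3 on, `outerDist` equals `hops` + 2, the general upper bound for `innerDist`. At 1
-- and 2 the inequality fails, whence the exceptional indices ±1, ±2.
inner≤outer : ∀ t → innerDist (3 + t) ≤ outerDist (3 + t)
inner≤outer t = s≤s (inner≤2+hops t)

cyc-inner≤outer : ∀ {n i} → 3 ≤ i → 3 ≤ n ∸ i → cycDist n true true i ≤ cycDist n false false i
cyc-inner≤outer 3≤i 3≤n∸i with m≤n⇒∃[o]m+o≡n 3≤i | m≤n⇒∃[o]m+o≡n 3≤n∸i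
... | t , refl | u , eq rewrite sym eq = ⊓-mono-≤ (inner≤outer t) (inner≤outer u)

-- The distances ℓ ≤ 6

-- The other arc is at least 25 ≥ k + 10 long, so `lineDist-+10` rules it out.
cycDist-small : ∀ {n k} b c → 40 ≤ n → k ≤ 15 → cycDist n b c k ≡ lineDist b c k
cycDist-small {n} {k} b c 40≤n k≤15 = m≤n⇒m⊓n≡m (lineDist-+10 b c k (begin
  k + 10     ≤⟨ +-monoˡ-≤ 10 k≤15 ⟩
  40 ∸ 15    ≤⟨ ∸-mono 40≤n k≤15 ⟩
  n ∸ k      ∎))
  where open ≤-Reasoning

lined : (ℕ → ℕ → ℕ → ℕ) → ℕ → ℕ → ℕ
lined near i k = near (outerDist i) (lineDist false true k) (innerDist i)

-- The terms at -1 and -2, that is n - 1 and n - 2, and at 0, ..., 15, freed from n by using line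
-- distances.
edgeSum : (ℕ → ℕ → ℕ → ℕ) → ℕ → ℕ
edgeSum near j = lined near 1 (1 + j) + (lined near 2 (2 + j) + Σ< 16 (λ i → lined near i ∣ i - j ∣))

reflected-low : ∀ {n j i} near → 40 ≤ n → i ≤ 15 → j ≤ 15 → reflected n near j i ≡ lined near i ∣ i - j ∣
reflected-low {n} {j} {i} near 40≤n i≤15 j≤15
  rewrite cycDist-small false false 40≤n i≤15 | cycDist-small true true 40≤n i≤15
        | cycDist-small false true 40≤n (≤-trans (∣m-n∣≤m⊔n i j) (⊔-lub i≤15 j≤15)) = refl

reflected-high : ∀ {n j} e near → 40 ≤ n → e + j ≤ 15 → reflected n near j (n ∸ e) ≡ lined near e (e + j)
reflected-high {n} {j} e near 40≤n e+j≤15 = go (≤-trans e+j≤15 (≤-trans (m≤m+n 15 25) 40≤n))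
  where
  e≤15 = m+n≤o⇒m≤o e e+j≤15
  go : e + j ≤ n → reflected n near j (n ∸ e) ≡ lined near e (e + j)
  go e+j≤n
    rewrite m≤n⇒∣n-m∣≡n∸m (m+n≤o⇒m≤o∸n j (subst (_≤ n) (+-comm e j) e+j≤n)) | ∸-+-assoc n e j
          | cycDist-∸ false false (m+n≤o⇒m≤o e e+j≤n) | cycDist-∸ true true (m+n≤o⇒m≤o e e+j≤n)
          | cycDist-∸ false true e+j≤n
          | cycDist-small false false 40≤n e≤15 | cycDist-small true true 40≤n e≤15
          | cycDist-small false true 40≤n e+j≤15 = refl

Σ<-ends : ∀ {n m j} near → 18 + m ≡ n → 40 ≤ n → 2 + j ≤ 15 → Σ< n (reflected n near j) ≡
          edgeSum near j + Σ< m (λ i → reflected n near j (16 + i))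
Σ<-ends {m = m} {j} near refl 40≤n 2+j≤15 = begin
  Σ< (18 + m) r
    ≡⟨ trans (Σ<-last (17 + m) r) (cong (r (17 + m) +_) (Σ<-last (16 + m) r)) ⟩
  r (17 + m) + (r (16 + m) + Σ< (16 + m) r)
    ≡⟨ cong₂ _+_ (reflected-high 1 near 40≤n (≤-trans (n≤1+n _) 2+j≤15))
        (cong₂ _+_ (reflected-high 2 near 40≤n 2+j≤15)
          (trans (Σ<-split 16 m r)
            (cong (_+ Σ< m (r ∘ (16 +_)))
              (Σ<-cong 16 (λ i i<16 → reflected-low near 40≤n (s≤s⁻¹ i<16) (≤-trans (n≤2+n j) 2+j≤15)))))) ⟩
  lined near 1 (1 + j) + (lined near 2 (2 + j) + (Σ< 16 (λ i → lined near i ∣ i - j ∣) + Σ< m (r ∘ (16 +_))))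
    ≡⟨ assoc (lined near 1 (1 + j)) (lined near 2 (2 + j)) _ _ ⟩
  edgeSum near j + Σ< m (r ∘ (16 +_)) ∎
  where
  open ≡-Reasoning
  r = reflected (18 + m) near j
  assoc : ∀ a b c d → a + (b + (c + d)) ≡ a + (b + c) + d
  assoc = solve-∀

-- The remaining indices 16, ..., n - 3 are at least 3 away from 0 on both sides, so there h ≤ f and
-- they cannot undo the strict inequality.
unbalanced-ends : ∀ {n j} → 40 ≤ n → 2 + j ≤ 15 → edgeSum nearU j < edgeSum nearV j →
                  Unbalanced n (suc (hops j)) j
unbalanced-ends {n} {j} 40≤n 2+j≤15 U<V = cycDist-small false true 40≤n (≤-trans (n≤2+n j) 2+j≤15) , <⇒≢
  (subst₂ _<_ (sym (Σ<-ends nearU n≡ 40≤n 2+j≤15)) (sym (Σ<-ends nearV n≡ 40≤n 2+j≤15))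
    (+-mono-<-≤ U<V (Σ<-mono m middle)))
  where
  m = n ∸ 18
  n≡ : 18 + m ≡ n
  n≡ = m+[n∸m]≡n (≤-trans (m≤m+n 18 22) 40≤n)
  3≤rest : ∀ i → i < m → 3 ≤ n ∸ (16 + i)
  3≤rest i i<m = m+n≤o⇒m≤o∸n 3 (≤-trans (≤-reflexive (sym (+-suc 18 i)))
    (≤-trans (+-monoʳ-≤ 18 i<m) (≤-reflexive n≡)))
  middle : ∀ i → i < m → reflected n nearU j (16 + i) ≤ reflected n nearV j (16 + i)
  middle i i<m = nearU≤nearV _ (inj₁ (cyc-inner≤outer {n} (m≤m+n 3 (13 + i)) (3≤rest i i<m)))

unbalanced-≤6 : ∀ {n ℓ} → 40 ≤ n → 1 ≤ ℓ → ℓ ≤ 6 → ∃[ j ] (j < n × Unbalanced n ℓ j)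
unbalanced-≤6 {n} {ℓ} 40≤n 1≤ℓ ℓ≤6 = go ℓ 1≤ℓ ℓ≤6
  where
  at : ∀ j → {True (2 + j ≤? 15)} → {True (edgeSum nearU j <? edgeSum nearV j)} →
       ∃[ i ] (i < n × Unbalanced n (suc (hops j)) i)
  at j {p} {q} = j , ≤-trans (n≤1+n _) (≤-trans (toWitness p) (≤-trans (m≤m+n 15 25) 40≤n)) ,
                 unbalanced-ends 40≤n (toWitness p) (toWitness q)
  go : ∀ ℓ → 1 ≤ ℓ → ℓ ≤ 6 → ∃[ j ] (j < n × Unbalanced n ℓ j)
  -- Each j has 1 + `hops` j = ℓ, and the comparison of the two values of `edgeSum` is decided by
  -- evaluation.
  go 1 _ _ = at 0
  go 2 _ _ = at 3
  go 3 _ _ = at 4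
  go 4 _ _ = at 9
  go 5 _ _ = at 12
  go 6 _ _ = at 11
  go (suc (suc (suc (suc (suc (suc (suc _))))))) _ (s≤s (s≤s (s≤s (s≤s (s≤s (s≤s ()))))))

-- The distances ℓ ≥ 7

hops-+ : ∀ e t → hops (e + t) ≤ e + hops t
hops-+ zero    t = ≤-refl
hops-+ (suc e) t = ≤-trans (hops-suc (e + t)) (s≤s (hops-+ e t))

hops-∸ : ∀ e t → hops t ≤ e + hops (e + t)
hops-∸ zero    t = ≤-refl
hops-∸ (suc e) t = ≤-trans (hops-∸ e t)
  (≤-trans (+-monoʳ-≤ e (hops-pred (e + t))) (≤-reflexive (+-suc e _)))

hops-3* : ∀ q t → hops (q * 3 + t) ≡ q + hops t
hops-3* zero    t = refl
hops-3* (suc q) t = cong suc (hops-3* q t)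

inner-3* : ∀ q → innerDist (q * 3) ≡ q
inner-3* zero    = refl
inner-3* (suc q) = cong suc (inner-3* q)

-- A shift by e ≤ 2 changes `hops` by at most 2, so it stays at least 4 on both arcs and the spoke
-- makes 5. This beats the v-v distance at offset e, which is at most 4.
far-uv : ∀ {e j a} → e ≤ 2 → 6 ≤ hops j → 6 ≤ hops (e + a) → 5 ≤ cycDist (a + (e + j)) false true a
far-uv {e} {j} {a} e≤2 6≤j 6≤e+a rewrite m+n∸m≡n a (e + j) = s≤s (⊓-glb
  (+-cancelˡ-≤ 2 4 _ (≤-trans 6≤e+a (≤-trans (hops-+ e a) (+-monoˡ-≤ _ e≤2))))
  (+-cancelˡ-≤ 2 4 _ (≤-trans 6≤j (≤-trans (hops-∸ e j) (+-monoˡ-≤ _ e≤2)))))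

inner-≤2 : ∀ {e} → e ≤ 2 → innerDist e ≤ 4
inner-≤2 {0} _ = z≤n
inner-≤2 {1} _ = s≤s (s≤s (s≤s z≤n))
inner-≤2 {2} _ = ≤-refl
inner-≤2 {suc (suc (suc _))} (s≤s (s≤s ()))

≤2⇒≤ : ∀ {e j} → e ≤ 2 → 6 ≤ hops j → e ≤ j
≤2⇒≤ {j = j} e≤2 6≤j = ≤-trans (≤-trans e≤2 (m≤m+n 2 4)) (≤-trans 6≤j (hops≤id j))

inner<uv-left : ∀ {j c i} → 6 ≤ hops j → 6 ≤ hops c → i ≤ 2 →
                cycDist (j + c) true true i < cycDist (j + c) false true ∣ i - j ∣
inner<uv-left {j} {c} {i} 6≤j 6≤c i≤2 with m≤n⇒∃[o]m+o≡n (≤2⇒≤ i≤2 6≤j)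
... | a , refl = ≤-trans (s≤s (≤-trans (m⊓n≤m _ _) (inner-≤2 i≤2)))
    (subst₂ (λ n k → 5 ≤ cycDist n false true k) (n≡ i a c) (sym (∣m-m+n∣≡n i a)) (far-uv {i} {c} i≤2 6≤c 6≤j))
  where
  n≡ : ∀ i a c → a + (i + c) ≡ i + a + c
  n≡ = solve-∀

inner<uv-right : ∀ {j c i e} → 6 ≤ hops j → 6 ≤ hops c → e ≤ 2 → i + e ≡ j + c →
                 cycDist (j + c) true true i < cycDist (j + c) false true ∣ i - j ∣
inner<uv-right {j} {c} {i} {e} 6≤j 6≤c e≤2 i+e≡n with m≤n⇒∃[o]m+o≡n (≤2⇒≤ e≤2 6≤c)
... | a , refl = ≤-trans
    (s≤s (≤-trans (m⊓n≤n _ _) (subst (λ k → innerDist k ≤ 4) e≡ (inner-≤2 e≤2))))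
    (subst₂ (λ n k → 5 ≤ cycDist n false true k) (n≡ e a j) a≡ (far-uv {e} {j} e≤2 6≤j 6≤c))
  where
  n≡ : ∀ e a j → a + (e + j) ≡ j + (e + a)
  n≡ = solve-∀
  n≡′ : ∀ e a j → j + (e + a) ≡ j + a + e
  n≡′ = solve-∀
  i≡ : i ≡ j + a
  i≡ = +-cancelʳ-≡ e i (j + a) (trans i+e≡n (n≡′ e a j))
  a≡ : a ≡ ∣ i - j ∣
  a≡ = sym (trans (cong (λ k → ∣ k - j ∣) i≡) (∣+ˡ-∣ j a))
  e≡ : e ≡ j + (e + a) ∸ i
  e≡ = sym (trans (cong (_∸ i) (sym i+e≡n)) (m+n∸m≡n i e))

nearU≤nearV-pointwise : ∀ {j c} → 6 ≤ hops j → 6 ≤ hops c → ∀ i → i < j + c →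
            reflected (j + c) nearU j i ≤ reflected (j + c) nearV j i
nearU≤nearV-pointwise {j} {c} 6≤j 6≤c i i<n = nearU≤nearV {cycDist (j + c) false false i} _ cases
  where
  cases : cycDist (j + c) true true i ≤ cycDist (j + c) false false i ⊎
            cycDist (j + c) true true i < cycDist (j + c) false true ∣ i - j ∣
  cases with 3 ≤? i | 3 ≤? j + c ∸ i
  ... | yes 3≤i | yes 3≤n∸i = inj₁ (cyc-inner≤outer {j + c} 3≤i 3≤n∸i)
  ... | no  3≰i | _         = inj₂ (inner<uv-left 6≤j 6≤c (s≤s⁻¹ (≰⇒> 3≰i)))
  ... | yes _   | no 3≰n∸i  = inj₂ (inner<uv-right 6≤j 6≤c (s≤s⁻¹ (≰⇒> 3≰n∸i)) (m+[n∸m]≡n (<⇒≤ i<n)))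

-- At i = 3p the direct arcs have lengths p for h, p + 2 for f and s + 3 for g, and s < p ≤ s + 2
-- puts s + 3 between p and p + 2. The bound on `hops` c keeps the other arcs from spoiling this.
nearU<nearV-midpoint : ∀ {p s c} → s < p → p ≤ 2 + s → 2 + (p + s) ≤ hops c → 1 ≤ s →
  let j = p * 3 + (s * 3 + 2) in
  reflected (j + c) nearU j (p * 3) < reflected (j + c) nearV j (p * 3)
nearU<nearV-midpoint {suc p} {s} {c} s<P p≤ c≥ s≥1 = nearU<nearV
  (≤-<-trans h≤ (<-≤-trans (n<1+n _) (≤-trans (n≤1+n _) f≥)))
  (≤-trans h≤ g≥) (≤-trans g≤ f≥)
  where
  P = suc p
  j = P * 3 + (s * 3 + 2)
  c≡ : j + c ∸ P * 3 ≡ s * 3 + (2 + c)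
  c≡ = trans (cong (_∸ P * 3) (lemma (P * 3) (s * 3) c)) (m+n∸m≡n (P * 3) _)
    where
    lemma : ∀ a b c → a + (b + 2) + c ≡ a + (b + (2 + c))
    lemma = solve-∀
  c≡′ : j + c ∸ (s * 3 + 2) ≡ P * 3 + c
  c≡′ = trans (cong (_∸ (s * 3 + 2)) (lemma (P * 3) (s * 3 + 2) c)) (m+n∸m≡n (s * 3 + 2) _)
    where
    lemma : ∀ a b c → a + b + c ≡ b + (a + c)
    lemma = solve-∀
  hops-P3 : outerDist (P * 3) ≡ 2 + P
  hops-P3 = cong (3 +_) (trans (cong hops (sym (+-identityʳ (p * 3)))) (trans (hops-3* p 0) (+-identityʳ p)))
  h≤ : cycDist (j + c) true true (P * 3) ≤ P
  h≤ = ≤-trans (m⊓n≤m _ _) (≤-reflexive (inner-3* P))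
  f≥ : 2 + P ≤ cycDist (j + c) false false (P * 3)
  f≥ = ⊓-glb (≤-reflexive (sym hops-P3)) (begin
    -- The other arc has offset 3s + 2 + c and `hops` at least 2s + `P`, so s ≥ 1 suffices.
    2 + P                        ≤⟨ +-mono-≤ s≥1 (+-monoˡ-≤ P s≥1) ⟩
    s + (s + P)                  ≤⟨ +-monoʳ-≤ s (+-cancelˡ-≤ 2 _ _ (begin
      2 + (s + P)                ≡⟨ cong (2 +_) (+-comm s P) ⟩
      2 + (P + s)                ≤⟨ c≥ ⟩
      hops c                     ≤⟨ hops-∸ 2 c ⟩
      2 + hops (2 + c)           ∎)) ⟩
    s + hops (2 + c)             ≡⟨ hops-3* s (2 + c) ⟨
    hops (s * 3 + (2 + c))       ≡⟨ cong hops c≡ ⟨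
    hops (j + c ∸ P * 3)         ≤⟨ hops≤outer _ ⟩
    outerDist (j + c ∸ P * 3)    ∎)
    where open ≤-Reasoning
  ∣i-j∣≡ : ∣ P * 3 - j ∣ ≡ s * 3 + 2
  ∣i-j∣≡ = ∣m-m+n∣≡n (P * 3) (s * 3 + 2)
  g≤ : cycDist (j + c) false true ∣ P * 3 - j ∣ ≤ 2 + P
  g≤ rewrite ∣i-j∣≡ = ≤-trans (m⊓n≤m _ _) (s≤s (≤-trans (≤-reflexive (trans (hops-3* s 2) (+-comm s 2))) (s≤s s<P)))
  g≥ : P ≤ cycDist (j + c) false true ∣ P * 3 - j ∣
  g≥ rewrite ∣i-j∣≡ = ⊓-glb
    (≤-trans p≤ (≤-trans (≤-reflexive (sym (trans (hops-3* s 2) (+-comm s 2)))) (n≤1+n _)))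
    (begin
      P                                    ≤⟨ m≤m+n P _ ⟩
      P + hops c                           ≡⟨ hops-3* P c ⟨
      hops (P * 3 + c)                     ≡⟨ cong hops c≡′ ⟨
      hops (j + c ∸ (s * 3 + 2))           ≤⟨ n≤1+n _ ⟩
      suc (hops (j + c ∸ (s * 3 + 2)))     ∎)
    where open ≤-Reasoning

-- 3q + 2 is the first offset at which `hops` reaches q + 2.
hops-large : ∀ q k → 2 + q ≤ hops k → 2 + q * 3 ≤ k
hops-large zero    k h = ≤-trans h (hops≤id k)
hops-large (suc q) 1 (s≤s ())
hops-large (suc q) 2 (s≤s (s≤s ()))
hops-large (suc q) (suc (suc (suc k))) (s≤s h) = s≤s (s≤s (s≤s (hops-large q k h)))

-- `hops` (2 + x) is below 2 only for x = 1, and a + b = 1 would force a = 1 or b = 1.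
hops-2+ : ∀ a b → 2 ≤ hops (2 + a) → 2 ≤ hops (2 + b) → 2 ≤ hops (2 + (a + b))
hops-2+ 0 b _ h = h
hops-2+ 1 b (s≤s ())
hops-2+ 2 b _ _ = s≤s (hops>0 b)
hops-2+ (suc (suc (suc a))) b _ _ = s≤s (hops>0 (suc (a + b)))

-- Both k and n − k are at least j = 3q + 2, so n − j is at least j; it is not 3q + 3 because neither is.
hops-complement : ∀ q {n k} → k ≤ n → 2 + q ≤ hops k → 2 + q ≤ hops (n ∸ k) →
  ∃[ c ] (q * 3 + 2 + c ≡ n × 2 + q ≤ hops c)
hops-complement q {n} {k} k≤n k≥ k′≥
  with m≤n⇒∃[o]m+o≡n (hops-large q k k≥) | m≤n⇒∃[o]m+o≡n (hops-large q (n ∸ k) k′≥)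
... | a , a≡ | b , b≡ = q * 3 + (2 + (a + b)) , c≡ , subst (2 + q ≤_) (sym (hops-3* q _))
    (≤-trans (≤-reflexive (+-comm 2 q)) (+-monoʳ-≤ q (hops-2+ a b (reduce a (subst (λ k → 2 + q ≤ hops k) (sym a≡) k≥))
                                                       (reduce b (subst (λ k → 2 + q ≤ hops k) (sym b≡) k′≥)))))
  where
  reduce : ∀ a → 2 + q ≤ hops (2 + q * 3 + a) → 2 ≤ hops (2 + a)
  reduce a h = +-cancelˡ-≤ q 2 _ (≤-trans (≤-reflexive (+-comm q 2))
    (subst (2 + q ≤_) (trans (cong hops (lemma (q * 3) a)) (hops-3* q (2 + a))) h))
    where
    lemma : ∀ r a → 2 + r + a ≡ r + (2 + a)
    lemma = solve-∀
  c≡ : q * 3 + 2 + (q * 3 + (2 + (a + b))) ≡ n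
  c≡ = trans (lemma (q * 3) a b) (trans (cong₂ _+_ a≡ b≡) (m+[n∸m]≡n k≤n))
    where
    lemma : ∀ r a b → r + 2 + (r + (2 + (a + b))) ≡ (2 + r + a) + (2 + r + b)
    lemma = solve-∀

-- With ℓ = 7 + t this splits ℓ - 3 almost evenly: p - s is 2 or 1 according to parity, as the
-- midpoint argument requires.
halves : ∀ t → ∃[ p ] ∃[ s ] (p + s ≡ 4 + t × s < p × p ≤ 2 + s × 1 ≤ s)
halves 0 = 3 , 1 , refl , s≤s (s≤s z≤n) , ≤-refl , s≤s z≤n
halves 1 = 3 , 2 , refl , ≤-refl , n≤1+n _ , s≤s z≤n
halves (suc (suc t)) with p , s , p+s≡ , s<p , p≤2+s , _ ← halves t =
  suc p , suc s , trans (cong suc (+-suc p s)) (cong (2 +_) p+s≡) , s≤s s<p , s≤s p≤2+s , s≤s z≤n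

-- Every term satisfies the weak inequality and the one at 3p the strict one. The bound 4 ≤ p + s
-- makes `hops` at least 6 at both j and c, which settles the exceptional indices.
unbalanced-mid : ∀ {p s c} → s < p → p ≤ 2 + s → 1 ≤ s → 4 ≤ p + s → 2 + (p + s) ≤ hops c →
  let j = p * 3 + (s * 3 + 2) in Unbalanced (j + c) (3 + (p + s)) j
unbalanced-mid {p} {s} {c} s<p p≤2+s 1≤s 4≤p+s c≥ =
  dj≡ , <⇒≢ (Σ<-mono-< (j + c) (nearU≤nearV-pointwise j≥6 c≥6) {p * 3} p*3<n (nearU<nearV-midpoint s<p p≤2+s c≥ 1≤s))
  where
  j = p * 3 + (s * 3 + 2)
  hops-j : hops j ≡ 2 + (p + s)
  hops-j = trans (hops-3* p _) (trans (cong (p +_) (hops-3* s 2)) (lemma p s))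
    where
    lemma : ∀ p s → p + (s + 2) ≡ 2 + (p + s)
    lemma = solve-∀
  j≥6 : 6 ≤ hops j
  j≥6 = ≤-trans (+-monoʳ-≤ 2 4≤p+s) (≤-reflexive (sym hops-j))
  c≥6 : 6 ≤ hops c
  c≥6 = ≤-trans (+-monoʳ-≤ 2 4≤p+s) c≥
  dj≡ : cycDist (j + c) false true j ≡ 3 + (p + s)
  dj≡ = trans (cong₂ (λ a b → suc (a ⊓ hops b)) hops-j (m+n∸m≡n j c)) (cong suc (m≤n⇒m⊓n≡m c≥))
  p*3<n : p * 3 < j + c
  p*3<n = ≤-<-trans (m≤m+n (p * 3) _) (m<m+n j (≤-trans (≤-trans (m≤m+n 1 5) c≥6) (hops≤id c)))

unbalanced-≥7 : ∀ {n ℓ k} → 7 ≤ ℓ → k < n → ℓ ≤ cycDist n false true k → ∃[ j ] (j < n × Unbalanced n ℓ j)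
unbalanced-≥7 {n} 7≤ℓ k<n ℓ≤
  with t , refl ← m≤n⇒∃[o]m+o≡n 7≤ℓ
  with p , s , p+s≡ , s<p , p≤2+s , 1≤s ← halves t
  -- The u-v distance at k being at least ℓ, both k and n - k have `hops` at least ℓ - 1 = 2 + (p +
  -- s).
  with c , n≡ , c≥ ← hops-complement (p + s) (<⇒≤ k<n)
    (s≤s⁻¹ (≤-trans (≤-reflexive (cong (3 +_) p+s≡)) (≤-trans ℓ≤ (m⊓n≤m _ _))))
    (s≤s⁻¹ (≤-trans (≤-reflexive (cong (3 +_) p+s≡)) (≤-trans ℓ≤ (m⊓n≤n _ _))))
  = p * 3 + (s * 3 + 2) , subst (p * 3 + (s * 3 + 2) <_) j+c≡n (m<m+n _ (≤-trans (≤-trans z<s c≥) (hops≤id c))) ,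
    subst₂ (λ n ℓ → Unbalanced n ℓ (p * 3 + (s * 3 + 2))) j+c≡n (cong (3 +_) p+s≡)
      (unbalanced-mid s<p p≤2+s 1≤s (≤-trans (m≤m+n 4 t) (≤-reflexive (sym p+s≡))) c≥)
  where
  lemma : ∀ p s c → p * 3 + (s * 3 + 2) + c ≡ (p + s) * 3 + 2 + c
  lemma = solve-∀
  j+c≡n = trans (lemma p s c) n≡

unbalanced-<40 : ∀ {n ℓ k} → 16 < n → n < 40 → 1 ≤ ℓ → k < n → ℓ ≤ cycDist n false true k →
                  ∃[ j ] (j < n × Unbalanced n ℓ j)
unbalanced-<40 {n} {ℓ} {k} 16<n n<40 1≤ℓ = subst
    (λ n → k < n → ℓ ≤ cycDist n false true k → ∃[ j ] (j < n × Unbalanced n ℓ j))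
    (m+[n∸m]≡n 16<n) (λ k<n ℓ≤ → go k<n ℓ≤ (unbalanced-table z<23 (≤-<-trans ℓ≤ (cycDist-<40 z<23 k<n))))
  where
  z = n ∸ 17
  z<23 : z < 23
  z<23 = ∸-monoˡ-< n<40 16<n
  go : k < 17 + z → ℓ ≤ cycDist (17 + z) false true k →
    ℓ ≡ 0 ⊎ (∀ {k} → k < 17 + z → cycDist (17 + z) false true k < ℓ) ⊎ ∃[ j ] (j < 17 + z × Unbalanced (17 + z) ℓ j) →
    ∃[ j ] (j < 17 + z × Unbalanced (17 + z) ℓ j)
  go _   _  (inj₁ ℓ≡0)          = contradiction (subst (1 ≤_) ℓ≡0 1≤ℓ) λ ()
  go k<n ℓ≤ (inj₂ (inj₁ all<ℓ)) = contradiction ℓ≤ (<⇒≱ (all<ℓ k<n))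
  go _   _  (inj₂ (inj₂ w))     = w

-- All n > 16, and the exception n = 16

unbalanced : ∀ {n ℓ k} → 16 < n → 1 ≤ ℓ → k < n → ℓ ≤ cycDist n false true k → ∃[ j ] (j < n × Unbalanced n ℓ j)
unbalanced {n} {ℓ} 16<n 1≤ℓ k<n ℓ≤ with 40 ≤? n | ℓ ≤? 6
... | no 40≰n  | _       = unbalanced-<40 16<n (≰⇒> 40≰n) 1≤ℓ k<n ℓ≤
... | yes 40≤n | yes ℓ≤6 = unbalanced-≤6 40≤n 1≤ℓ ℓ≤6
... | yes _    | no  ℓ≰6 = unbalanced-≥7 (≰⇒> ℓ≰6) k<n ℓ≤

not-balanced : ∀ n .{{_ : NonZero n}} → 16 < n → ∀ ℓ → 1 ≤ ℓ → ℓ < diam n 3 → ¬ DistBalanced n 3 ℓ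
not-balanced n 16<n ℓ 1≤ℓ ℓ<diam =
  let 10≤n = ≤-trans (m≤m+n 10 7) 16<n
      k , k<n , ℓ≤ = <diam⇒≤cycDist 10≤n ℓ<diam
      j , j<n , u  = unbalanced 16<n 1≤ℓ k<n ℓ≤
  in Unbalanced⇒¬DistBalanced 10≤n j<n u

10≤16 : 10 ≤ 16
10≤16 = m≤m+n 10 6

cycDist≤diam : ∀ {n} .{{_ : NonZero n}} → 10 ≤ n → ∀ b c (i j : Fin n) → cycDist n b c ∣ toℕ i - toℕ j ∣ ≤ diam n 3
cycDist≤diam {n} 10≤n b c i j = subst (_≤ diam n 3) (Petersen.dist≡ n 10≤n b c i j) (dist≤diam n (b , i) (c , j))

balanced⇒DistBalanced : ∀ {n} .{{_ : NonZero n}} {ℓ} → 10 ≤ n →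
  (∀ b c {i} → i < n → ∀ {j} → j < n → cycDist n b c ∣ i - j ∣ ≡ ℓ →
    closer n false b i c j + closer n true b i c j ≡ closer n false c j b i + closer n true c j b i) →
  DistBalanced n 3 ℓ
balanced⇒DistBalanced {n} 10≤n bal (b , i) (c , j) d≡ℓ =
  trans (cardW≡ n 10≤n b i c j)
    (trans (bal b c (toℕ<n i) (toℕ<n j) (trans (sym (Petersen.dist≡ n 10≤n b c i j)) d≡ℓ))
      (sym (cardW≡ n 10≤n c j b i)))

-- Witnessed by u₀ and u₈, which are at distance 6.
5<diam-16 : 5 < diam 16 3
5<diam-16 = cycDist≤diam 10≤16 false false (# 0) (# 8)

distBalanced-16-5 : DistBalanced 16 3 5
distBalanced-16-5 = balanced⇒DistBalanced 10≤16 balanced-16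

theorem1p3 : ((n : ℕ) → .{{_ : NonZero n}} → 16 < n →
    (ℓ : ℕ) → 1 ≤ ℓ → ℓ < diam n 3 → ¬ DistBalanced n 3 ℓ)
    × (∃[ ℓ ] (1 ≤ ℓ × ℓ < diam 16 3 × DistBalanced 16 3 ℓ))
theorem1p3 = (λ n → not-balanced n) , 5 , s≤s z≤n , 5<diam-16 , distBalanced-16-5
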